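{- We have $\#\overline{T}(\alpha)=\infty$ for almost all $\alpha\in(0,2/3)$.
   Context: "Almost all" is with respect to the $1$-dimensional Lebesgue measure. $\mathbb{N}$ is the set of positive integers; $\lceil x\rceil$ is the least integer greater than or equal to $x$. For a set $X$ of integers, $T(X)$ is the set of all tuples $(k,\ell,m)\in\mathbb{N}^3$ with $k\leq \ell\leq m$ such that all of $k,\ \ell,\ m,\ k+\ell,\ \ell+m,\ m+k,\ k+\ell+m$ belong to $X$. Let $\overline{S}(\alpha)=\{\lceil\alpha n^2\rceil : n\in\mathbb{N}\}$ and $\overline{T}(\alpha)=T(\overline{S}(\alpha))$. -}

module Defs where

open import Data.Nat as ℕ using (ℕ; zero; suc)
open import Data.Integer as ℤ using (ℤ)
open import Data.Product using (Σ; ∃; _×_; _,_; proj₁; proj₂)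
open import Data.Rational
open import Data.Rational.Properties
open import Function.Definitions using (Injective)
open import Level using (0ℓ)
open import Relation.Binary.PropositionalEquality
open import Relation.Nullary using (¬_)
open import Relation.Unary using (Pred; _∈_; _∉_)

-- Real numbers are Cauchy sequences of rationals together with a modulus of
-- convergence (the untruncated ∃ below).  Two sequences with the same limit
-- are not identified; everything below only depends on the limit.

IsCauchy : (ℕ → ℚ) → Set
IsCauchy x = ∀ (ε : ℚ) → 0ℚ < ε →
  ∃ λ N → ∀ m n → N ℕ.≤ m → N ℕ.≤ n → ∣ x m - x n ∣ < ε

record ℝ : Set where
  constructor mkℝ
  field
    approx : ℕ → ℚ
    cauchy : IsCauchy approx

open ℝ public

infix 4 _<ᵣ_ _≤ᵣ_
infixr 7 _·_

_<ᵣ_ : ℝ → ℝ → Set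
x <ᵣ y = ∃ λ (ε : ℚ) → 0ℚ < ε ×
  ∃ λ N → ∀ n → N ℕ.≤ n → approx x n + ε ≤ approx y n

_≤ᵣ_ : ℝ → ℝ → Set
x ≤ᵣ y = ¬ (y <ᵣ x)

fromℚ : ℚ → ℝ
fromℚ q = mkℝ (λ _ → q) λ ε 0<ε →
  0 , λ _ _ _ _ → subst (_< ε) (cong ∣_∣ (sym (+-inverseʳ q))) 0<ε

fromℤ : ℤ → ℝ
fromℤ z = fromℚ (z / 1)

_·_ : ℚ → ℝ → ℝ
c · x = mkℝ (λ n → c * approx x n) scaled
  where
  p : ℚ
  p = 1ℚ + ∣ c ∣

  instance
    p-pos : Positive p
    p-pos = pos+nonNeg⇒pos 1ℚ ∣ c ∣ {{∣-∣-nonNeg c}}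

    p-nonZero : NonZero p
    p-nonZero = pos⇒nonZero p

    1/p-pos : Positive (1/ p)
    1/p-pos = 1/pos⇒pos p

  ∣c∣≤p : ∣ c ∣ ≤ p
  ∣c∣≤p = subst (_≤ p) (+-identityˡ ∣ c ∣) (+-monoˡ-≤ ∣ c ∣ (nonNegative⁻¹ 1ℚ))

  scaled : IsCauchy (λ n → c * approx x n)
  scaled ε 0<ε = proj₁ modulus , bound
    where
    δ : ℚ
    δ = 1/ p * ε

    modulus : ∃ λ N → ∀ m n → N ℕ.≤ m → N ℕ.≤ n → ∣ approx x m - approx x n ∣ < δ
    modulus = cauchy x δ
      (positive⁻¹ δ {{pos*pos⇒pos (1/ p) ε {{positive 0<ε}}}})

    bound : ∀ m n → proj₁ modulus ℕ.≤ m → proj₁ modulus ℕ.≤ n →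
            ∣ c * approx x m - c * approx x n ∣ < ε
    bound m n N≤m N≤n = begin-strict
      ∣ c * a - c * b ∣      ≡⟨ cong (λ t → ∣ c * a + t ∣) (neg-distribʳ-* c b) ⟩
      ∣ c * a + c * (- b) ∣  ≡⟨ cong ∣_∣ (*-distribˡ-+ c a (- b)) ⟨
      ∣ c * (a - b) ∣        ≡⟨ ∣p*q∣≡∣p∣*∣q∣ c (a - b) ⟩
      ∣ c ∣ * ∣ a - b ∣      ≤⟨ *-monoʳ-≤-nonNeg ∣ a - b ∣ {{∣-∣-nonNeg (a - b)}} ∣c∣≤p ⟩
      p * ∣ a - b ∣          <⟨ *-monoʳ-<-pos p (proj₂ modulus m n N≤m N≤n) ⟩
      p * (1/ p * ε)         ≡⟨ *-assoc p (1/ p) ε ⟨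
      (p * 1/ p) * ε         ≡⟨ cong (_* ε) (*-inverseʳ p) ⟩
      1ℚ * ε                 ≡⟨ *-identityˡ ε ⟩
      ε                      ∎
      where
      open ≤-Reasoning
      a = approx x m
      b = approx x n

-- z = ⌈x⌉.  A relation, since the ceiling is not a computable function.

IsCeiling : ℝ → ℤ → Set
IsCeiling x z = x ≤ᵣ fromℤ z × (∀ w → x ≤ᵣ fromℤ w → z ℤ.≤ w)

OpenInterval : ℚ → ℚ → Pred ℝ 0ℓ
OpenInterval a b x = fromℚ a <ᵣ x × x <ᵣ fromℚ b

sumUpTo : (ℕ → ℚ) → ℕ → ℚ
sumUpTo f zero    = 0ℚ
sumUpTo f (suc n) = sumUpTo f n + f n

-- A countable family of open intervals.  Requiring rational endpoints does not
-- change which sets can be covered with arbitrarily small total length.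

record IntervalFamily : Set where
  field
    left right : ℕ → ℚ
    left≤right : ∀ i → left i ≤ right i

open IntervalFamily public

⋃ : IntervalFamily → Pred ℝ 0ℓ
⋃ I x = ∃ λ i → x ∈ OpenInterval (left I i) (right I i)

TotalLength≤ : IntervalFamily → ℚ → Set
TotalLength≤ I ε = ∀ n → sumUpTo (λ i → right I i - left I i) n ≤ ε

-- Lebesgue-almost every x in D satisfies P: the exceptional set
-- { x ∈ D | ¬ P x } is covered by open intervals of arbitrarily small total
-- length.  The covering condition is written in contrapositive form, i.e. P
-- holds at each point of D outside the cover, because from ¬ P x alone one
-- cannot constructively compute the index of an interval containing x.

AlmostAll : Pred ℝ 0ℓ → Pred ℝ 0ℓ → Set
AlmostAll D P = ∀ (ε : ℚ) → 0ℚ < ε →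
  Σ IntervalFamily λ I → TotalLength≤ I ε × (∀ x → x ∈ D → x ∉ ⋃ I → x ∈ P)

Infinite : {A : Set} → Pred A 0ℓ → Set
Infinite {A} X = ∃ λ (f : ℕ → A) → Injective _≡_ _≡_ f × (∀ n → f n ∈ X)

T : Pred ℤ 0ℓ → Pred (ℕ × ℕ × ℕ) 0ℓ
T X (k , l , m) =
  (1 ℕ.≤ k × 1 ℕ.≤ l × 1 ℕ.≤ m) ×
  (k ℕ.≤ l × l ℕ.≤ m) ×
  (ℤ.+ k ∈ X × ℤ.+ l ∈ X × ℤ.+ m ∈ X) ×
  (ℤ.+ (k ℕ.+ l) ∈ X × ℤ.+ (l ℕ.+ m) ∈ X × ℤ.+ (m ℕ.+ k) ∈ X) ×
  ℤ.+ (k ℕ.+ l ℕ.+ m) ∈ X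

S̄ : ℝ → Pred ℤ 0ℓ
S̄ α z = ∃ λ n → 1 ℕ.≤ n × IsCeiling ((ℤ.+ (n ℕ.^ 2) / 1) · α) z

T̄ : ℝ → Pred (ℕ × ℕ × ℕ) 0ℓ
T̄ α = T (S̄ α)

{-# OPTIONS --safe #-}

-- If a² = 2c + 2 and d² = 2a² + 1, then a² + a² = d² − 1, a² + c² = (c + 1)² + 1 and
-- a² + a² + c² = (c + 2)².  Hence for k = ⌈αa²⌉ and m = ⌈αc²⌉ the triple (k, k, m) belongs to T̄(α) as soon
-- as k − αa² slightly exceeds α/2 and m − αc² is small: writing these two defects as δ and δ′, one needs
-- α ≤ 2δ, δ + δ′ + α < 1 and 2δ + δ′ < 1, which leaves room exactly when α < 2/3.  The first equation and the
-- Pell equation d² − 2a² = 1 have solutions with c arbitrarily large, and then c² is much larger than a².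
-- So a fixed proportion (depending only on the distances to 0 and 2/3) of any interval of α's is filled by
-- finitely many subintervals on which both conditions hold, chosen first at scale 1/a² and then at scale 1/c².
-- Applying this again to the remaining pieces makes the measure of the bad set arbitrarily small.

module Submission where

open import Defs
open import Data.Integer as ℤ using (ℤ; +_)
import Data.Integer.Properties as ℤ
open import Data.Nat as ℕ using (ℕ; zero; suc)
import Data.Nat.Properties as ℕ
import Data.Nat.Coprimality as ℕ
open import Data.Nat.Tactic.RingSolver using () renaming (solve-∀ to ℕ-solve-∀)
open import Data.List using (List; []; _∷_; _++_)
open import Data.List.Relation.Unary.Any using (Any; here; there)
open import Data.List.Relation.Unary.Any.Properties using (++⁺ˡ; ++⁺ʳ)
open import Data.Maybe using (Maybe; nothing; just)
open import Data.Product using (Σ; ∃; ∃₂; _×_; _,_; proj₁; proj₂)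
open import Data.Sum using (_⊎_; inj₁; inj₂)
open import Data.Rational
open import Data.Rational.Properties
open import Function using (_∘_)
open import Function.Definitions using (Injective)
open import Level using (0ℓ)
open import Relation.Binary using (tri<; tri≈; tri>)
open import Relation.Binary.PropositionalEquality
open import Relation.Nullary using (¬_; Dec; yes; no; contradiction)
open import Relation.Unary using (Pred; _∈_)
open import Tactic.RingSolver using (solve; solve-∀)
open import Tactic.RingSolver.Core.AlmostCommutativeRing using (AlmostCommutativeRing; fromCommutativeRing)

-- Inequalities as nonnegative combinations of hypotheses

ℚ-ring : AlmostCommutativeRing 0ℓ 0ℓ
ℚ-ring = fromCommutativeRing +-*-commutativeRing 0≟
  where
  0≟ : ∀ x → Maybe (0ℚ ≡ x)
  0≟ x with 0ℚ ≟ x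
  ... | yes 0≡x = just 0≡x
  ... | no  _   = nothing

private variable
  u v w x y z e δ ε ρ σ τ : ℚ
  G : ℚ → ℚ → Set

infixr 6 _⊕_
infixr 7 _⊗_

_⊕_ : 0ℚ ≤ x → 0ℚ ≤ y → 0ℚ ≤ x + y
_⊕_ {x} {y} 0≤x 0≤y =
  nonNegative⁻¹ (x + y) {{nonNeg+nonNeg⇒nonNeg x {{nonNegative 0≤x}} y {{nonNegative 0≤y}}}}

_⊗_ : 0ℚ ≤ x → 0ℚ ≤ y → 0ℚ ≤ x * y
_⊗_ {x} {y} 0≤x 0≤y =
  nonNegative⁻¹ (x * y) {{nonNeg*nonNeg⇒nonNeg x {{nonNegative 0≤x}} y {{nonNegative 0≤y}}}}

_⊞_ : 0ℚ < x → 0ℚ ≤ y → 0ℚ < x + y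
_⊞_ {x} {y} 0<x 0≤y = positive⁻¹ (x + y) {{pos+nonNeg⇒pos x {{positive 0<x}} y {{nonNegative 0≤y}}}}

*-pos : 0ℚ < x → 0ℚ < y → 0ℚ < x * y
*-pos {x} {y} 0<x 0<y =
  positive⁻¹ (x * y) {{pos*pos⇒pos x {{positive 0<x}} y {{positive 0<y}}}}

gap : x ≤ y → 0ℚ ≤ y - x
gap {x} {y} x≤y = subst (_≤ y - x) (+-inverseʳ x) (+-monoˡ-≤ (- x) x≤y)

-- The term is zero, so an equation may enter a nonnegative combination with a factor `q` of either
-- sign.
eqGap : ∀ q → x ≡ y → 0ℚ ≤ q * (y - x)
eqGap {x} q refl = ≤-reflexive (sym (trans (cong (q *_) (+-inverseʳ x)) (*-zeroʳ q)))

-- The scheme of nearly all estimates below: the slack `e` is a nonnegative combination of gaps of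
-- hypotheses, and the remaining polynomial identity is left to the ring solver.
≤-by : 0ℚ ≤ e → y ≡ x + e → x ≤ y
≤-by {e} {y} {x} 0≤e y≡ = subst (x ≤_) (sym y≡) (subst (_≤ x + e) (+-identityʳ x) (+-monoʳ-≤ x 0≤e))

<-by : 0ℚ < e → y ≡ x + e → x < y
<-by {e} {y} {x} 0<e y≡ = subst (x <_) (sym y≡) (subst (_< x + e) (+-identityʳ x) (+-monoʳ-< x 0<e))

0≤const : ∀ q .{{_ : NonNegative q}} → 0ℚ ≤ q
0≤const q = nonNegative⁻¹ q

gap-< : x < y → 0ℚ < y - x
gap-< {x} {y} x<y = subst (_< y - x) (+-inverseʳ x) (+-monoˡ-< (- x) x<y)

-- Integers inside ℚ

-- Opaque because the normal form of z / 1 unfolds its gcd computation.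
opaque
  ι : ℤ → ℚ
  ι z = z / 1

ν : ℕ → ℚ
ν n = ι (+ n)

opaque
  unfolding ι

  ι-def : ∀ z → z / 1 ≡ ι z
  ι-def z = refl

  mkℚ-ι : ∀ z → ι z ≡ mkℚ z 0 (ℕ.sym (ℕ.1-coprimeTo ℤ.∣ z ∣))
  mkℚ-ι z = ↥p/↧p≡p (mkℚ z 0 (ℕ.sym (ℕ.1-coprimeTo ℤ.∣ z ∣)))

  ι-homo-+ : ∀ i j → ι (i ℤ.+ j) ≡ ι i + ι j
  ι-homo-+ i j = sym (trans (cong₂ _+_ (mkℚ-ι i) (mkℚ-ι j))
    (cong ι (cong₂ ℤ._+_ (ℤ.*-identityʳ i) (ℤ.*-identityʳ j))))

  ι-homo-* : ∀ i j → ι (i ℤ.* j) ≡ ι i * ι j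
  ι-homo-* i j = sym (cong₂ _*_ (mkℚ-ι i) (mkℚ-ι j))

  ι-mono-≤ : ∀ {i j} → i ℤ.≤ j → ι i ≤ ι j
  ι-mono-≤ {i} {j} i≤j = subst₂ _≤_ (sym (mkℚ-ι i)) (sym (mkℚ-ι j))
    (*≤* (subst₂ ℤ._≤_ (sym (ℤ.*-identityʳ i)) (sym (ℤ.*-identityʳ j)) i≤j))

  ι-step : ∀ {i j} → i ℤ.< j → 1ℚ + ι i ≤ ι j
  ι-step {i} i<j = subst (_≤ _) (ι-homo-+ (+ 1) i) (ι-mono-≤ (ℤ.i<j⇒suc[i]≤j i<j))

  ν-zero : ν 0 ≡ 0ℚ
  ν-zero = refl

  ν-suc : ∀ n → ν (suc n) ≡ 1ℚ + ν n
  ν-suc n = ι-homo-+ (+ 1) (+ n)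

ν-homo-+ : ∀ m n → ν (m ℕ.+ n) ≡ ν m + ν n
ν-homo-+ m n = ι-homo-+ (+ m) (+ n)

ν-homo-* : ∀ m n → ν (m ℕ.* n) ≡ ν m * ν n
ν-homo-* m n = trans (cong ι (ℤ.pos-* m n)) (ι-homo-* (+ m) (+ n))

ν-mono-≤ : ∀ {m n} → m ℕ.≤ n → ν m ≤ ν n
ν-mono-≤ m≤n = ι-mono-≤ (ℤ.+≤+ m≤n)

0≤ν : ∀ n → 0ℚ ≤ ν n
0≤ν n = subst (_≤ ν n) ν-zero (ν-mono-≤ {0} {n} ℕ.z≤n)

ν-cancel-≤ : ∀ {m n} → ν m < 1ℚ + ν n → m ℕ.≤ n
ν-cancel-≤ {m} {n} m<1+n with m ℕ.≤? n
... | yes m≤n = m≤n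
... | no  m≰n = contradiction (<-≤-trans m<1+n (ι-step (ℤ.+<+ (ℕ.≰⇒> m≰n)))) (<-irrefl refl)

natural-above : ∀ x → ∃ λ n → x < ν n
natural-above x = suc n , (begin-strict
  x              ≤⟨ x≤n x ⟩
  ν n            <⟨ <-by {e = 1ℚ} (positive⁻¹ 1ℚ) (trans (ν-suc n) (+-comm 1ℚ (ν n))) ⟩
  ν (suc n)      ∎)
  where
  open ≤-Reasoning
  n = ℤ.∣ ↥ x ∣
  -- Denominators are at least 1, so the absolute value of the numerator is already a bound.
  x≤n : ∀ x → x ≤ ν ℤ.∣ ↥ x ∣
  x≤n x@(mkℚ (+ a) _ _) = subst (x ≤_) (sym (mkℚ-ι (+ a)))
    (*≤* (ℤ.*-monoˡ-≤-nonNeg (+ a) {+ 1} (ℤ.+≤+ (ℕ.s≤s ℕ.z≤n))))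
  x≤n x@(mkℚ (ℤ.-[1+ a ]) _ _) = ≤-trans {j = 0ℚ} (nonPositive⁻¹ x) (0≤ν (suc a))

floorℕ : ∀ x → 0ℚ ≤ x → ∃ λ n → ν n ≤ x × x < 1ℚ + ν n
floorℕ x 0≤x = search (proj₁ (natural-above x)) (proj₂ (natural-above x))
  where
  search : ∀ n → x < ν n → ∃ λ n → ν n ≤ x × x < 1ℚ + ν n
  search zero    x<0 = contradiction (<-≤-trans (subst (x <_) ν-zero x<0) 0≤x) (<-irrefl refl)
  search (suc n) x<n with x <? ν n
  ... | yes x<n′ = search n x<n′
  ... | no  x≮n  = n , ≮⇒≥ x≮n , subst (x <_) (ν-suc n) x<n

reciprocal : 0ℚ < x → ∃ λ y → 0ℚ < y × y * x ≡ 1ℚ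
reciprocal {x} 0<x = 1/ x , positive⁻¹ (1/ x) {{1/pos⇒pos x}} , *-inverseˡ x
  where instance
    x-pos : Positive x
    x-pos = positive 0<x
    x-nonZero : NonZero x
    x-nonZero = pos⇒nonZero x

archimedean : 0ℚ < x → ∀ y → ∃ λ n → y ≤ ν n * x
archimedean {x} 0<x y with reciprocal 0<x
... | r , 0<r , rx≡1 with natural-above (y * r)
...   | n , yr<n = n , bound (ν n) yr<n
  where
  bound : ∀ N → y * r < N → y ≤ N * x
  bound N yr<N = ≤-by (gap (<⇒≤ yr<N) ⊗ <⇒≤ 0<x ⊕ eqGap (- y) rx≡1) (solve (x ∷ y ∷ r ∷ N ∷ []) ℚ-ring)

-- Real numbers in rational intervals

p≤∣p∣ : ∀ p → p ≤ ∣ p ∣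
p≤∣p∣ p with ∣p∣≡p∨∣p∣≡-p p
... | inj₁ eq = ≤-reflexive (sym eq)
... | inj₂ eq = ≤-by (0≤∣p∣ p ⊕ subst (0ℚ ≤_) eq (0≤∣p∣ p)) (lemma p ∣ p ∣)
  where
  lemma : ∀ p q → q ≡ p + (q + - p)
  lemma = solve-∀ ℚ-ring

near : ∀ (α : ℝ) → 0ℚ < δ → ∃ λ N → ∀ m n → N ℕ.≤ m → N ℕ.≤ n → approx α m ≤ δ + approx α n
near {δ} α 0<δ with cauchy α δ 0<δ
... | N , close = N , λ m n N≤m N≤n →
  lemma (approx α m) (approx α n) (≤-trans (p≤∣p∣ _) (<⇒≤ (close m n N≤m N≤n)))
  where
  lemma : ∀ a b → a - b ≤ δ → a ≤ δ + b
  lemma a b a-b≤δ = ≤-by (gap a-b≤δ) (solve (a ∷ b ∷ δ ∷ []) ℚ-ring)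

-- Definitionally, Above u α = (fromℚ u <ᵣ α) and Below v α = (α <ᵣ fromℚ v); but these forms do not
-- mention the convergence proof of fromℚ, whose normal form is huge.
Above Below : ℚ → Pred ℝ 0ℓ
Above u α = ∃ λ ε → 0ℚ < ε × ∃ λ N → ∀ n → N ℕ.≤ n → u + ε ≤ approx α n
Below v α = ∃ λ ε → 0ℚ < ε × ∃ λ N → ∀ n → N ℕ.≤ n → approx α n + ε ≤ v

Between : ℚ → ℚ → Pred ℝ 0ℓ
Between u v α = Above u α × Below v α

-- Comparing a real with `w` is undecidable, but comparing a rational `p` within `δ` of it is not.
-- If `p` is within `2δ` of `w`, then `α` is within `3δ`, and a fourth `δ` provides the margin that
-- `Between` demands.
trisect : ∀ (α : ℝ) w → 0ℚ < δ →
          Below w α ⊎ Above w α ⊎ Between (w - (δ + δ + δ + δ)) (w + (δ + δ + δ + δ)) α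
trisect {δ} α w 0<δ = compare (approx α N) (λ n N≤n → close N n ℕ.≤-refl N≤n) (λ n N≤n → close n N N≤n ℕ.≤-refl)
  where
  N = proj₁ (near α 0<δ)
  close = proj₂ (near α 0<δ)

  compare : ∀ p → (∀ n → N ℕ.≤ n → p ≤ δ + approx α n) → (∀ n → N ℕ.≤ n → approx α n ≤ δ + p) →
            Below w α ⊎ Above w α ⊎ Between (w - (δ + δ + δ + δ)) (w + (δ + δ + δ + δ)) α
  compare p p≤ ≤p with w ≤? p + δ + δ | p ≤? w + δ + δ
  ... | no w≰ | _ =
    inj₁ (δ , 0<δ , N , λ n N≤n → lemma (approx α n) (≤p n N≤n) (<⇒≤ (≰⇒> w≰)))
    where
    lemma : ∀ a → a ≤ δ + p → p + δ + δ ≤ w → a + δ ≤ w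
    lemma a h₁ h₂ = ≤-by (gap h₁ ⊕ gap h₂) (solve (a ∷ p ∷ δ ∷ w ∷ []) ℚ-ring)
  ... | yes _ | no p≰ =
    inj₂ (inj₁ (δ , 0<δ , N , λ n N≤n → lemma (approx α n) (p≤ n N≤n) (<⇒≤ (≰⇒> p≰))))
    where
    lemma : ∀ a → p ≤ δ + a → w + δ + δ ≤ p → w + δ ≤ a
    lemma a h₁ h₂ = ≤-by (gap h₁ ⊕ gap h₂) (solve (a ∷ p ∷ δ ∷ w ∷ []) ℚ-ring)
  ... | yes w≤ | yes p≤w =
    inj₂ (inj₂ ( (δ , 0<δ , N , λ n N≤n → below (approx α n) (p≤ n N≤n) w≤)
               , (δ , 0<δ , N , λ n N≤n → above (approx α n) (≤p n N≤n) p≤w)))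
    where
    below : ∀ a → p ≤ δ + a → w ≤ p + δ + δ → w - (δ + δ + δ + δ) + δ ≤ a
    below a h₁ h₂ = ≤-by (gap h₁ ⊕ gap h₂) (solve (a ∷ p ∷ δ ∷ w ∷ []) ℚ-ring)
    above : ∀ a → a ≤ δ + p → p ≤ w + δ + δ → a + δ ≤ w + (δ + δ + δ + δ)
    above a h₁ h₂ = ≤-by (gap h₁ ⊕ gap h₂) (solve (a ∷ p ∷ δ ∷ w ∷ []) ℚ-ring)

-- The chain `z - 1 ≤ x * u < x * α < x * v ≤ z` determines the ceiling. Strictness comes from `α`
-- alone, so weak inequalities at the rational endpoints suffice.
interval-ceiling : ∀ {α : ℝ} {z} → 0ℚ < x → Between u v α →
                   z / 1 ≤ 1ℚ + x * u → x * v ≤ z / 1 → IsCeiling (x · α) z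
interval-ceiling {x} {u} {v} {α} {z} 0<x ((ε , 0<ε , N , u<α) , (ε′ , 0<ε′ , N′ , α<v)) z≤1+xu xv≤z =
  is-upper , least
  where
  is-upper : ¬ (fromℤ z <ᵣ x · α)
  is-upper (e , 0<e , M , z<xα) =
    contradiction (<-≤-trans 0<e (lemma (approx α n) (z / 1) (z<xα n (ℕ.m≤m⊔n M N′)) (α<v n (ℕ.m≤n⊔m M N′)) xv≤z))
                  (<-irrefl refl)
    where
    n = M ℕ.⊔ N′
    lemma : ∀ a Z → Z + e ≤ x * a → a + ε′ ≤ v → x * v ≤ Z → e ≤ 0ℚ
    lemma a Z h₁ h₂ h₃ = ≤-by (gap h₁ ⊕ <⇒≤ 0<x ⊗ (gap h₂ ⊕ <⇒≤ 0<ε′) ⊕ gap h₃)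
      (solve (a ∷ Z ∷ e ∷ x ∷ v ∷ ε′ ∷ []) ℚ-ring)
  least : ∀ w → ¬ (fromℤ w <ᵣ x · α) → z ℤ.≤ w
  least w ≮ with z ℤ.≤? w
  ... | yes z≤w = z≤w
  ... | no  z≰w = contradiction
    (x * ε , *-pos 0<x 0<ε , N , λ n N≤n → lemma (approx α n) (w / 1) (z / 1) (u<α n N≤n) (subst₂ (λ W Z → 1ℚ + W ≤ Z) (sym (ι-def w)) (sym (ι-def z)) (ι-step (ℤ.≰⇒> z≰w))) z≤1+xu) ≮
    where
    lemma : ∀ a W Z → u + ε ≤ a → 1ℚ + W ≤ Z → Z ≤ 1ℚ + x * u → W + x * ε ≤ x * a
    lemma a W Z h₁ h₂ h₃ = ≤-by (<⇒≤ 0<x ⊗ gap h₁ ⊕ gap h₂ ⊕ gap h₃)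
      (solve (a ∷ W ∷ Z ∷ u ∷ x ∷ ε ∷ []) ℚ-ring)
-- Dissections of an interval into good and bad pieces

data Dissection (G : ℚ → ℚ → Set) : ℚ → ℚ → Set where
  good : u ≤ v → G u v → Dissection G u v
  bad  : u ≤ v → Dissection G u v
  cut  : Dissection G u w → Dissection G w v → Dissection G u v

waste : Dissection G u v → ℚ
waste (good _ _)          = 0ℚ
waste (bad {u} {v} _)     = v - u
waste (cut D E)           = waste D + waste E

ordered : Dissection G u v → u ≤ v
ordered (good u≤v _) = u≤v
ordered (bad u≤v)    = u≤v
ordered (cut D E)    = ≤-trans (ordered D) (ordered E)

0≤waste : (D : Dissection G u v) → 0ℚ ≤ waste D
0≤waste (good _ _) = ≤-refl
0≤waste (bad u≤v)  = gap u≤v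
0≤waste (cut D E)  = 0≤waste D ⊕ 0≤waste E

DenseOn : (ℚ → ℚ → Set) → ℚ → ℚ → ℚ → Set
DenseOn G ρ a b = ∀ {u v} → a ≤ u → u ≤ v → v ≤ b →
  Σ (Dissection G u v) λ D → waste D ≤ (1ℚ - ρ) * (v - u)

module _ {a b : ℚ} (0≤ρ : 0ℚ ≤ ρ) (dense : DenseOn G ρ a b) where

  -- Good pieces are kept and every bad piece is dissected anew; the factor `1ℚ - ρ` is the same for
  -- all of them, so it passes to the sum.
  refine : a ≤ u → v ≤ b → (D : Dissection G u v) →
           Σ (Dissection G u v) λ E → waste E ≤ (1ℚ - ρ) * waste D
  refine a≤u v≤b (good u≤v g) = good u≤v g , ≤-reflexive (sym (*-zeroʳ (1ℚ - ρ)))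
  refine a≤u v≤b (bad u≤v)    = dense a≤u u≤v v≤b
  refine a≤u v≤b (cut D E) =
    let D′ , D′≤ = refine a≤u (≤-trans (ordered E) v≤b) D
        E′ , E′≤ = refine (≤-trans a≤u (ordered D)) v≤b E
    in cut D′ E′ ,
       ≤-trans (+-mono-≤ D′≤ E′≤) (≤-reflexive (sym (*-distribˡ-+ (1ℚ - ρ) (waste D) (waste E))))

  -- Geometric decay is replaced by the weaker bound `1 / (1 + n ρ)`, which avoids powers. The
  -- induction rests on `(1 - ρ)(1 + (n + 1) ρ) ≤ 1 + n ρ`.
  iterate : a ≤ b → ∀ n → Σ (Dissection G a b) λ D → waste D * (1ℚ + ν n * ρ) ≤ b - a
  iterate a≤b zero    = bad a≤b , ≤-reflexive (lemma (b - a) ρ)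
    where
    lemma : ∀ x ρ → x * (1ℚ + ν 0 * ρ) ≡ x
    lemma x ρ rewrite ν-zero = solve (x ∷ ρ ∷ []) ℚ-ring
  iterate a≤b (suc n) =
    let D , D≤ = iterate a≤b n
        E , E≤ = refine ≤-refl ≤-refl D
    in E , lemma (waste D) (waste E) (ν n) (ν (suc n)) (b - a) (0≤waste D) (0≤ν n) (ν-suc n) E≤ D≤
    where
    lemma : ∀ d e N N′ L → 0ℚ ≤ d → 0ℚ ≤ N → N′ ≡ 1ℚ + N → e ≤ (1ℚ - ρ) * d →
            d * (1ℚ + N * ρ) ≤ L → e * (1ℚ + N′ * ρ) ≤ L
    lemma d e N _ L 0≤d 0≤N refl e≤ d≤ = ≤-by
      (gap d≤ ⊕ gap e≤ ⊗ (0≤const 1ℚ ⊕ (0≤const 1ℚ ⊕ 0≤N) ⊗ 0≤ρ) ⊕ 0≤d ⊗ (0≤const 1ℚ ⊕ 0≤N) ⊗ 0≤ρ ⊗ 0≤ρ)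
      (solve (d ∷ e ∷ N ∷ L ∷ ρ ∷ []) ℚ-ring)

small-waste : ∀ {a b} → 0ℚ < ρ → DenseOn G ρ a b → a ≤ b → 0ℚ < ε → Σ (Dissection G a b) λ D → waste D ≤ ε
small-waste {ρ} {_} {ε} {a} {b} 0<ρ dense a≤b 0<ε =
  D , *-cancelʳ-≤-pos (1ℚ + ν n * ρ) {{positive 0<1+nρ}}
        (lemma (waste D) (ν n) (b - a) (proj₂ large) (proj₂ iterated))
  where
  large = archimedean (*-pos 0<ρ 0<ε) (b - a)
  n = proj₁ large
  iterated = iterate (<⇒≤ 0<ρ) dense a≤b n
  D = proj₁ iterated
  0<1+nρ : 0ℚ < 1ℚ + ν n * ρ
  0<1+nρ = <-≤-trans (positive⁻¹ 1ℚ) (≤-by (0≤ν n ⊗ <⇒≤ 0<ρ) refl)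
  lemma : ∀ d N L → L ≤ N * (ρ * ε) → d * (1ℚ + N * ρ) ≤ L → d * (1ℚ + N * ρ) ≤ ε * (1ℚ + N * ρ)
  lemma d N L h₁ h₂ = ≤-by (gap h₁ ⊕ gap h₂ ⊕ <⇒≤ 0<ε) (solve (d ∷ N ∷ L ∷ ρ ∷ ε ∷ []) ℚ-ring)
-- Covering the bad pieces by open intervals

record Interval : Set where
  constructor interval
  field
    {lower upper} : ℚ
    lower≤upper   : lower ≤ upper

open Interval

width : Interval → ℚ
width I = upper I - lower I

total : List Interval → ℚ
total []       = 0ℚ
total (I ∷ Is) = width I + total Is

_∈ᴵ_ : ℝ → Interval → Set
α ∈ᴵ I = Between (lower I) (upper I) α

total-++ : ∀ Is Js → total (Is ++ Js) ≡ total Is + total Js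
total-++ []       Js = sym (+-identityˡ (total Js))
total-++ (I ∷ Is) Js = trans (cong (λ t → width I + t) (total-++ Is Js)) (sym (+-assoc (width I) (total Is) (total Js)))

Covers : (ℚ → ℚ → Set) → ℚ → ℚ → List Interval → Set
Covers G u v Is = ∀ α → Between u v α → ¬ Any (α ∈ᴵ_) Is → ∃₂ λ a b → G a b × Between a b α

quarter : 0ℚ < x → ∃ λ y → 0ℚ < y × y + y + y + y ≡ x
quarter {x} 0<x = (½ * ½) * x , *-pos (positive⁻¹ (½ * ½)) 0<x , solve (x ∷ []) ℚ-ring

-- Cutting at w leaves the point w itself uncovered, hence the additional short interval around w.
cover : (D : Dissection G u v) → 0ℚ < δ → ∃ λ Is → total Is ≤ waste D + δ × Covers G u v Is
cover {δ = δ} (good {u} {v} _ g) 0<δ = [] , ≤-by (<⇒≤ 0<δ) refl , λ α α∈ _ → u , v , g , α∈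
cover {δ = δ} (bad {u} {v} u≤v) 0<δ = interval u≤v ∷ [] , ≤-by (<⇒≤ 0<δ) (lemma u v δ) ,
  λ α α∈ α∉ → contradiction (here α∈) α∉
  where
  lemma : ∀ u v δ → v - u + δ ≡ v - u + 0ℚ + δ
  lemma = solve-∀ ℚ-ring
cover {G = G} {δ = δ} (cut {u = u} {w = w} {v = v} D E) 0<δ = Is ++ sliver ∷ Js , total≤ , covers
  where
  -- With `κ = δ / 4` and `η = κ / 4`, the two halves cost `κ` each and the sliver of length `8η`
  -- costs `2κ`, which adds up to `δ`.
  κ = proj₁ (quarter 0<δ)
  0<κ = proj₁ (proj₂ (quarter 0<δ))
  η = proj₁ (quarter 0<κ)
  0<η = proj₁ (proj₂ (quarter 0<κ))
  4η≡κ = proj₂ (proj₂ (quarter 0<κ))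
  D-cover = cover D 0<κ
  E-cover = cover E 0<κ
  Is = proj₁ D-cover
  Js = proj₁ E-cover
  sliver : Interval
  sliver = interval {w - (η + η + η + η)} {w + (η + η + η + η)} (lemma η 0≤4η)
    where
    0≤4η : 0ℚ ≤ η + η + η + η
    0≤4η = subst (0ℚ ≤_) (sym 4η≡κ) (<⇒≤ 0<κ)
    lemma : ∀ η → 0ℚ ≤ η + η + η + η → w - (η + η + η + η) ≤ w + (η + η + η + η)
    lemma η 0≤4η = ≤-by (0≤4η ⊕ 0≤4η) (solve (w ∷ η ∷ []) ℚ-ring)
  total≤ : total (Is ++ sliver ∷ Js) ≤ waste D + waste E + δ
  total≤ = subst (_≤ waste D + waste E + δ) (sym (total-++ Is (sliver ∷ Js)))
    (lemma (total Is) (total Js) (waste D) (waste E) κ η δ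
      (proj₁ (proj₂ D-cover)) (proj₁ (proj₂ E-cover)) 4η≡κ (proj₂ (proj₂ (quarter 0<δ))))
    where
    lemma : ∀ i j d e κ η δ → i ≤ d + κ → j ≤ e + κ → η + η + η + η ≡ κ → κ + κ + κ + κ ≡ δ →
            i + ((w + (η + η + η + η) - (w - (η + η + η + η))) + j) ≤ d + e + δ
    lemma i j d e _ η _ i≤ j≤ refl refl = ≤-by (gap i≤ ⊕ gap j≤)
      (solve (i ∷ j ∷ d ∷ e ∷ w ∷ η ∷ []) ℚ-ring)
  covers : Covers G u v (Is ++ sliver ∷ Js)
  covers α (u<α , α<v) α∉ = split (trisect α w 0<η)
    where
    split : Below w α ⊎ Above w α ⊎ Between (w - (η + η + η + η)) (w + (η + η + η + η)) α →
            ∃₂ λ a b → G a b × Between a b α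
    split (inj₁ α<w)        = proj₂ (proj₂ D-cover) α (u<α , α<w) (α∉ ∘ ++⁺ˡ)
    split (inj₂ (inj₁ w<α)) = proj₂ (proj₂ E-cover) α (w<α , α<v) (α∉ ∘ ++⁺ʳ Is ∘ there)
    split (inj₂ (inj₂ α∈))  = contradiction (++⁺ʳ Is (here α∈)) α∉

-- Concatenating finite families

module Concatenation (L : ℕ → List Interval) where

  -- A cursor: the index of the current list together with the part of it still to be emitted.
  next : ℕ × List Interval → ℕ × List Interval
  next (j , [])     = suc j , L (suc j)
  next (j , _ ∷ Is) = j , Is

  state : ℕ → ℕ × List Interval
  state zero    = 0 , L 0
  state (suc n) = next (state n)

  current : ℕ × List Interval → Interval
  -- The end of each list, empty or not, takes one step of its own; the degenerate interval emitted
  -- there has length zero.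
  current (_ , [])    = interval {0ℚ} ≤-refl
  current (_ , I ∷ _) = I

  family : IntervalFamily
  family = record
    { left       = λ n → lower (current (state n))
    ; right      = λ n → upper (current (state n))
    ; left≤right = λ n → lower≤upper (current (state n))
    }

  reach-end : ∀ {n j} Is → state n ≡ (j , Is) → ∃ λ m → state m ≡ (suc j , L (suc j))
  reach-end {n} []       eq = suc n , cong next eq
  reach-end {n} (_ ∷ Is) eq = reach-end {suc n} Is (cong next eq)

  reach : ∀ j → ∃ λ n → state n ≡ (j , L j)
  reach zero    = 0 , refl
  reach (suc j) = let n , eq = reach j in reach-end {n} (L j) eq

  any-current : ∀ {P : Pred Interval 0ℓ} {n j Is} → state n ≡ (j , Is) → Any P Is → ∃ λ m → P (current (state m))
  any-current {P} {n} eq (here p) = n , subst (P ∘ current) (sym eq) p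
  any-current {n = n} eq (there p) = any-current {n = suc n} (cong next eq) p

  ∉-family : ∀ {α} → ¬ α ∈ ⋃ family → ∀ j → ¬ Any (α ∈ᴵ_) (L j)
  ∉-family {α} α∉ j α∈ = α∉ (any-current {α ∈ᴵ_} {proj₁ (reach j)} (proj₂ (reach j)) α∈)

  module _ {ε} (budget : ℕ → ℚ) (0≤budget : ∀ j → 0ℚ ≤ budget j)
           (first : total (L 0) + budget 0 ≤ ε)
           (later : ∀ j → total (L (suc j)) + budget (suc j) ≤ budget j) where

    -- A potential for bounding the partial sums: `budget j` is the reserve for all lists after the
    -- `j`-th. Each step pays at most what the potential drops by.
    owed : ℕ × List Interval → ℚ
    owed (j , Is) = total Is + budget j

    owed-next : ∀ s → width (current s) + owed (next s) ≤ owed s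
    owed-next (j , [])     = ≤-by (gap (later j)) (lemma (total (L (suc j))) (budget (suc j)) (budget j))
      where
      lemma : ∀ t b b′ → 0ℚ + b′ ≡ 0ℚ - 0ℚ + (t + b) + (b′ - (t + b))
      lemma = solve-∀ ℚ-ring
    owed-next (j , I ∷ Is) = ≤-reflexive (sym (+-assoc (width I) (total Is) (budget j)))

    0≤owed : ∀ s → 0ℚ ≤ owed s
    0≤owed (j , [])     = ≤-refl ⊕ 0≤budget j
    0≤owed (j , I ∷ Is) = subst (0ℚ ≤_) (sym (+-assoc (width I) (total Is) (budget j)))
      (gap (lower≤upper I) ⊕ 0≤owed (j , Is))

    paid+owed : ∀ n → sumUpTo (λ i → width (current (state i))) n + owed (state n) ≤ ε
    paid+owed zero    = subst (_≤ ε) (sym (+-identityˡ _)) first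
    paid+owed (suc n) = ≤-trans (lemma (sumUpTo (λ i → width (current (state i))) n) (width (current (state n)))
      (owed (state n)) (owed (state (suc n))) (owed-next (state n))) (paid+owed n)
      where
      lemma : ∀ s l o o′ → l + o′ ≤ o → s + l + o′ ≤ s + o
      lemma s l o o′ h = ≤-by (gap h) (solve (s ∷ l ∷ o ∷ o′ ∷ []) ℚ-ring)

    length-bound : TotalLength≤ family ε
    length-bound n = ≤-trans (≤-by (0≤owed (state n)) refl) (paid+owed n)

-- Tiling an interval by the multiples of r

-- Only the two incomplete cells at the ends are lost. They amount to at most two cell lengths,
-- hence at most half of `[u, v]` when this is four cells long; so the proportion `σ` is at worst
-- halved.
tile : ∀ {r A} → 0ℚ < r → r * A ≡ 1ℚ → 0ℚ ≤ A → 0ℚ ≤ σ → 0ℚ ≤ u → 1ℚ + 1ℚ + 1ℚ + 1ℚ ≤ A * (v - u) →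
       (∀ i → u ≤ ν i * r → ν (suc i) * r ≤ v →
         Σ (Dissection G (ν i * r) (ν (suc i) * r)) λ D → waste D ≤ (1ℚ - σ) * r) →
       Σ (Dissection G u v) λ D → waste D ≤ (1ℚ - ½ * σ) * (v - u)
tile {σ} {u} {v} {G} {r} {A} 0<r rA≡1 0≤A 0≤σ 0≤u 4≤A[v-u] cell =
  cut (bad u≤first) (cut (proj₁ middle) (bad last≤v)) ,
  waste-bound (ν i₀) (ν n) (ν j) (ν (n ℕ.+ j)) (waste (proj₁ middle))
    (ν-suc i₀) (ν-homo-+ n j) i₀≤ <n (proj₂ middle)
  where
  0≤r = <⇒≤ 0<r

  -- `j * r` is the first multiple of `r` beyond `u`, and `n` counts the complete cells from there
  -- to `v`.
  below = floorℕ (A * u) (0≤A ⊗ 0≤u)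
  i₀ = proj₁ below
  j = suc i₀
  i₀≤ = proj₁ (proj₂ below)

  0≤rest : ∀ I J → J ≡ 1ℚ + I → I ≤ A * u → 0ℚ ≤ A * v - J
  0≤rest I _ refl I≤ = ≤-by (gap 4≤A[v-u] ⊕ gap I≤ ⊕ 0≤const 1ℚ ⊕ 0≤const 1ℚ ⊕ 0≤const 1ℚ)
    (solve (A ∷ u ∷ v ∷ I ∷ []) ℚ-ring)

  count = floorℕ (A * v - ν j) (0≤rest (ν i₀) (ν j) (ν-suc i₀) i₀≤)
  n = proj₁ count
  n≤ = proj₁ (proj₂ count)
  <n = <⇒≤ (proj₂ (proj₂ count))

  u≤first : u ≤ ν j * r
  u≤first = lemma (ν j) (subst (A * u ≤_) (sym (ν-suc i₀)) (<⇒≤ (proj₂ (proj₂ below))))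
    where
    lemma : ∀ J → A * u ≤ J → u ≤ J * r
    lemma J h = ≤-by (0≤r ⊗ gap h ⊕ eqGap (- u) rA≡1) (solve (J ∷ u ∷ A ∷ r ∷ []) ℚ-ring)

  last≤v : ν (n ℕ.+ j) * r ≤ v
  last≤v = lemma (ν n) (ν j) (ν (n ℕ.+ j)) (ν-homo-+ n j) n≤
    where
    lemma : ∀ N J S → S ≡ N + J → N ≤ A * v - J → S * r ≤ v
    lemma N J _ refl h = ≤-by (0≤r ⊗ gap h ⊕ eqGap v rA≡1) (solve (N ∷ J ∷ v ∷ A ∷ r ∷ []) ℚ-ring)

  cells : ∀ n j → u ≤ ν j * r → ν (n ℕ.+ j) * r ≤ v →
          Σ (Dissection G (ν j * r) (ν (n ℕ.+ j) * r)) λ D → waste D ≤ ν n * ((1ℚ - σ) * r)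
  cells zero j _ _ = bad ≤-refl , lemma (ν j) (ν 0) ν-zero
    where
    lemma : ∀ J Z → Z ≡ 0ℚ → J * r - J * r ≤ Z * ((1ℚ - σ) * r)
    lemma J _ refl = ≤-reflexive (solve (J ∷ r ∷ σ ∷ []) ℚ-ring)
  cells (suc n) j u≤ ≤v =
    let D , D≤ = cells n j u≤ (≤-trans (*-monoʳ-≤-nonNeg r {{nonNegative 0≤r}} (ν-mono-≤ (ℕ.n≤1+n (n ℕ.+ j)))) ≤v)
        E , E≤ = cell (n ℕ.+ j) (≤-trans u≤ (*-monoʳ-≤-nonNeg r {{nonNegative 0≤r}} (ν-mono-≤ (ℕ.m≤n+m j n)))) ≤v
    in cut D E , lemma (waste D) (waste E) (ν n) (ν (suc n)) (ν-suc n) D≤ E≤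
    where
    lemma : ∀ d e N S → S ≡ 1ℚ + N → d ≤ N * ((1ℚ - σ) * r) → e ≤ (1ℚ - σ) * r → d + e ≤ S * ((1ℚ - σ) * r)
    lemma d e N _ refl h₁ h₂ = ≤-by (gap h₁ ⊕ gap h₂) (solve (d ∷ e ∷ N ∷ r ∷ σ ∷ []) ℚ-ring)

  middle = cells n j u≤first last≤v

  waste-bound : ∀ I N J S d → J ≡ 1ℚ + I → S ≡ N + J → I ≤ A * u → A * v - J ≤ 1ℚ + N →
                d ≤ N * ((1ℚ - σ) * r) →
                J * r - u + (d + (v - S * r)) ≤ (1ℚ - ½ * σ) * (v - u)
  waste-bound I N _ _ d refl refl h₁ h₂ h₃ = ≤-by
    (gap h₃ ⊕ 0≤σ ⊗ 0≤r ⊗ (gap h₁ ⊕ gap h₂ ⊕ 0≤const ½ ⊗ gap 4≤A[v-u]) ⊕ eqGap (- (½ * σ * (v - u))) rA≡1)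
    (solve (I ∷ N ∷ d ∷ u ∷ v ∷ σ ∷ r ∷ A ∷ []) ℚ-ring)

-- The Pell equation

record Pell (c : ℕ) : Set where
  field
    a d : ℕ
    1≤a : 1 ℕ.≤ a
    1≤c : 1 ℕ.≤ c
    1≤d : 1 ℕ.≤ d
    a²  : a ℕ.* a ≡ c ℕ.+ c ℕ.+ 2
    d²  : d ℕ.* d ≡ a ℕ.* a ℕ.+ a ℕ.* a ℕ.+ 1

-- The step from `(a , d)` to `(3a + 2d , 4a + 3d)` is multiplication of `d + a√2` by the unit
-- `3 + 2√2`, starting from `3 + 2√2` itself.
pell-above : ∀ M → ∃ λ c → M ℕ.≤ c × Pell c
pell-above zero    = 1 , ℕ.z≤n , record
  { a = 2 ; d = 3 ; 1≤a = ℕ.s≤s ℕ.z≤n ; 1≤c = ℕ.s≤s ℕ.z≤n ; 1≤d = ℕ.s≤s ℕ.z≤n ; a² = refl ; d² = refl }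
pell-above (suc M) =
  let c , M≤c , P = pell-above M
      open Pell P
      growth = ℕ.+-mono-≤ (ℕ.*-mono-≤ 1≤d 1≤d) (ℕ.≤-trans M≤c (ℕ.m≤m+n c _))
  -- This is `(a′² - 2) / 2` for the new `a′`, written without subtraction and with `d * d ≥ 1` in
  -- front so that the growth over `c` is visible.
  in d ℕ.* d ℕ.+ (c ℕ.+ (4 ℕ.* (a ℕ.* a) ℕ.+ 6 ℕ.* (a ℕ.* d) ℕ.+ d ℕ.* d)) ,
     growth , record
  { a = 3 ℕ.* a ℕ.+ 2 ℕ.* d
  ; d = 4 ℕ.* a ℕ.+ 3 ℕ.* d
  ; 1≤a = ℕ.≤-trans 1≤a (ℕ.≤-trans (ℕ.m≤n*m a 3) (ℕ.m≤m+n (3 ℕ.* a) (2 ℕ.* d)))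
  ; 1≤c = ℕ.≤-trans (ℕ.s≤s ℕ.z≤n) growth
  ; 1≤d = ℕ.≤-trans 1≤a (ℕ.≤-trans (ℕ.m≤n*m a 4) (ℕ.m≤m+n (4 ℕ.* a) (3 ℕ.* d)))
  ; a² = next-a² a c d a²
  ; d² = next-d² a d d²
  }
  where
  next-a² : ∀ a c d → a ℕ.* a ≡ c ℕ.+ c ℕ.+ 2 →
    let a′ = 3 ℕ.* a ℕ.+ 2 ℕ.* d
        c′ = d ℕ.* d ℕ.+ (c ℕ.+ (4 ℕ.* (a ℕ.* a) ℕ.+ 6 ℕ.* (a ℕ.* d) ℕ.+ d ℕ.* d))
    in a′ ℕ.* a′ ≡ c′ ℕ.+ c′ ℕ.+ 2
  next-a² a c d a² = trans (expand a d) (trans (cong (ℕ._+ (8 ℕ.* (a ℕ.* a) ℕ.+ 12 ℕ.* (a ℕ.* d) ℕ.+ 4 ℕ.* (d ℕ.* d))) a²) (collect a c d))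
    where
    expand : ∀ a d → (3 ℕ.* a ℕ.+ 2 ℕ.* d) ℕ.* (3 ℕ.* a ℕ.+ 2 ℕ.* d) ≡
                   a ℕ.* a ℕ.+ (8 ℕ.* (a ℕ.* a) ℕ.+ 12 ℕ.* (a ℕ.* d) ℕ.+ 4 ℕ.* (d ℕ.* d))
    expand = ℕ-solve-∀
    collect : ∀ a c d → c ℕ.+ c ℕ.+ 2 ℕ.+ (8 ℕ.* (a ℕ.* a) ℕ.+ 12 ℕ.* (a ℕ.* d) ℕ.+ 4 ℕ.* (d ℕ.* d)) ≡
      d ℕ.* d ℕ.+ (c ℕ.+ (4 ℕ.* (a ℕ.* a) ℕ.+ 6 ℕ.* (a ℕ.* d) ℕ.+ d ℕ.* d)) ℕ.+
      (d ℕ.* d ℕ.+ (c ℕ.+ (4 ℕ.* (a ℕ.* a) ℕ.+ 6 ℕ.* (a ℕ.* d) ℕ.+ d ℕ.* d))) ℕ.+ 2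
    collect = ℕ-solve-∀
  next-d² : ∀ a d → d ℕ.* d ≡ a ℕ.* a ℕ.+ a ℕ.* a ℕ.+ 1 →
    let a′ = 3 ℕ.* a ℕ.+ 2 ℕ.* d
        d′ = 4 ℕ.* a ℕ.+ 3 ℕ.* d
    in d′ ℕ.* d′ ≡ a′ ℕ.* a′ ℕ.+ a′ ℕ.* a′ ℕ.+ 1
  next-d² a d d² = trans (expand a d) (trans (cong (ℕ._+ (16 ℕ.* (a ℕ.* a) ℕ.+ 24 ℕ.* (a ℕ.* d) ℕ.+ 8 ℕ.* (d ℕ.* d))) d²) (collect a d))
    where
    expand : ∀ a d → (4 ℕ.* a ℕ.+ 3 ℕ.* d) ℕ.* (4 ℕ.* a ℕ.+ 3 ℕ.* d) ≡
                   d ℕ.* d ℕ.+ (16 ℕ.* (a ℕ.* a) ℕ.+ 24 ℕ.* (a ℕ.* d) ℕ.+ 8 ℕ.* (d ℕ.* d))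
    expand = ℕ-solve-∀
    collect : ∀ a d → a ℕ.* a ℕ.+ a ℕ.* a ℕ.+ 1 ℕ.+ (16 ℕ.* (a ℕ.* a) ℕ.+ 24 ℕ.* (a ℕ.* d) ℕ.+ 8 ℕ.* (d ℕ.* d)) ≡
      (3 ℕ.* a ℕ.+ 2 ℕ.* d) ℕ.* (3 ℕ.* a ℕ.+ 2 ℕ.* d) ℕ.+ (3 ℕ.* a ℕ.+ 2 ℕ.* d) ℕ.* (3 ℕ.* a ℕ.+ 2 ℕ.* d) ℕ.+ 1
    collect = ℕ-solve-∀

-- Triples in T̄(α) from a solution of the Pell equation

1ν : ν 1 ≡ 1ℚ
1ν = trans (ν-suc 0) (trans (cong (λ t → 1ℚ + t) ν-zero) (+-identityʳ 1ℚ))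

-- `X` is kept apart from `ν n * ν n` so that each square can be supplied as a polynomial in `A` and
-- `ν c`.
∈S̄ : ∀ u v α {X z} n → 1 ℕ.≤ n → X ≡ ν n * ν n → Between u v α →
      ν z ≤ 1ℚ + X * u → X * v ≤ ν z → S̄ α (+ z)
∈S̄ u v α {_} {z} n 1≤n refl α∈ z≤ ≤z = n , 1≤n ,
  interval-ceiling {x = + (n ℕ.^ 2) / 1} {u} {v} {α} {+ z} 0<n² α∈
    (subst₂ (λ Z X → Z ≤ 1ℚ + X * u) (sym (ι-def (+ z))) (sym n²) z≤)
    (subst₂ (λ Z X → X * v ≤ Z) (sym (ι-def (+ z))) (sym n²) ≤z)
  where
  n² : + (n ℕ.^ 2) / 1 ≡ ν n * ν n
  n² = trans (ι-def (+ (n ℕ.^ 2))) (trans (cong ν (cong (n ℕ.*_) (ℕ.*-identityʳ n))) (ν-homo-* n n))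
  0<n : 0ℚ < ν n
  0<n = <-≤-trans (positive⁻¹ 1ℚ) (subst (_≤ ν n) 1ν (ν-mono-≤ 1≤n))
  0<n² : 0ℚ < + (n ℕ.^ 2) / 1
  0<n² = subst (0ℚ <_) (sym n²) (*-pos 0<n 0<n)

-- One triple serves the whole open interval; the lower bound on `k` is what later yields infinitely
-- many distinct triples.
Solved : ℕ → ℚ → ℚ → Set
Solved K u v = ∃₂ λ k m → K ℕ.< k × (∀ α → Between u v α → (k , k , m) ∈ T̄ α)

-- On [u, v] the defects k − a²α and m − c²α stay in [s, s + τ] and [0, τ].  As a² + a² = d² − 1,
-- a² + c² = (c + 1)² + 1 and a² + a² + c² = (c + 2)², with α ≤ 2s, this bounds the defects of all sums.
solved : ∀ {K k m c A s} (P : Pell c) → K ℕ.< k →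
         A ≡ ν c + ν c + (1ℚ + 1ℚ) → 0ℚ < τ → s + s + s + (τ + τ + τ) ≤ 1ℚ →
         0ℚ < u → u ≤ v → v ≤ s + s → A ≤ ν c * ν c →
         ν k - s - τ ≤ A * u → A * v ≤ ν k - s →
         ν m - τ ≤ ν c * ν c * u → ν c * ν c * v ≤ ν m →
         Solved K u v
solved {τ} {u} {v} {K} {k} {m} {c} {A} {s} P K<k A≡ 0<τ small 0<u u≤v v≤2s A≤C k≤ ≤k m≤ ≤m =
  k , m , K<k , λ α α∈ →
    (1≤k , 1≤k , ℕ.≤-trans 1≤k k≤m) , (ℕ.≤-refl , k≤m) ,
    (∈S̄ u v α a 1≤a A≡a² α∈ A-lower A-upper , ∈S̄ u v α a 1≤a A≡a² α∈ A-lower A-upper ,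
     ∈S̄ u v α c 1≤c refl α∈ (C-lower (ν c) (ν m) m≤) ≤m) ,
    (∈S̄ u v α d 1≤d 2A+1≡d² α∈ (2k-lower (ν k) k≤ (ν-homo-+ k k)) (2k-upper (ν k) ≤k (ν-homo-+ k k)) ,
     ∈S̄ u v α (suc c) (ℕ.s≤s ℕ.z≤n) C+A-1≡ α∈
       (k+m-lower (ν c) (ν k) (ν m) k≤ m≤ (ν-homo-+ k m)) (k+m-upper (ν c) (ν k) (ν m) ≤k ≤m (ν-homo-+ k m)) ,
     ∈S̄ u v α (suc c) (ℕ.s≤s ℕ.z≤n) C+A-1≡ α∈
       (k+m-lower (ν c) (ν k) (ν m) k≤ m≤ ν[m+k]) (k+m-upper (ν c) (ν k) (ν m) ≤k ≤m ν[m+k])) ,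
    ∈S̄ u v α (suc (suc c)) (ℕ.s≤s ℕ.z≤n) C+2A≡ α∈
      (k+k+m-lower (ν c) (ν k) (ν m) k≤ m≤ ν[k+k+m]) (k+k+m-upper (ν c) (ν k) (ν m) ≤k ≤m ν[k+k+m])
  where
  open Pell P
  1≤k : 1 ℕ.≤ k
  1≤k = ℕ.≤-trans (ℕ.s≤s ℕ.z≤n) K<k

  0≤τ = <⇒≤ 0<τ
  0≤u = <⇒≤ 0<u
  0≤v = ≤-trans 0≤u u≤v
  0≤2s : 0ℚ ≤ s + s
  0≤2s = ≤-trans 0≤v v≤2s
  0≤s : 0ℚ ≤ s
  0≤s = ≤-by {x = 0ℚ} (0≤const ½ ⊗ 0≤2s) (solve (s ∷ []) ℚ-ring)

  2ν : ν 2 ≡ 1ℚ + 1ℚ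
  2ν = trans (ν-suc 1) (cong (λ t → 1ℚ + t) 1ν)

  A≡a² : A ≡ ν a * ν a
  A≡a² = trans A≡ (sym (trans (sym (ν-homo-* a a)) (trans (cong ν a²)
    (trans (ν-homo-+ (c ℕ.+ c) 2) (cong₂ _+_ (ν-homo-+ c c) 2ν)))))

  2A+1≡d² : A + A + 1ℚ ≡ ν d * ν d
  2A+1≡d² = sym (trans (sym (ν-homo-* d d)) (trans (cong ν d²) (trans (ν-homo-+ (a ℕ.* a ℕ.+ a ℕ.* a) 1)
    (cong₂ _+_ (trans (ν-homo-+ (a ℕ.* a) (a ℕ.* a)) (cong₂ _+_ a²≡A a²≡A)) 1ν))))
    where
    a²≡A : ν (a ℕ.* a) ≡ A
    a²≡A = trans (ν-homo-* a a) (sym A≡a²)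

  C+A-1≡ : ν c * ν c + A - 1ℚ ≡ ν (suc c) * ν (suc c)
  C+A-1≡ = lemma (ν c) (ν (suc c)) A A≡ (ν-suc c)
    where
    lemma : ∀ γ γ′ A → A ≡ γ + γ + (1ℚ + 1ℚ) → γ′ ≡ 1ℚ + γ → γ * γ + A - 1ℚ ≡ γ′ * γ′
    lemma γ _ _ refl refl = solve (γ ∷ []) ℚ-ring

  C+2A≡ : ν c * ν c + (A + A) ≡ ν (suc (suc c)) * ν (suc (suc c))
  C+2A≡ = lemma (ν c) (ν (suc (suc c))) A A≡ (trans (ν-suc (suc c)) (cong (λ t → 1ℚ + t) (ν-suc c)))
    where
    lemma : ∀ γ γ′ A → A ≡ γ + γ + (1ℚ + 1ℚ) → γ′ ≡ 1ℚ + (1ℚ + γ) → γ * γ + (A + A) ≡ γ′ * γ′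
    lemma γ _ _ refl refl = solve (γ ∷ []) ℚ-ring

  ν[m+k] : ν (m ℕ.+ k) ≡ ν k + ν m
  ν[m+k] = trans (ν-homo-+ m k) (+-comm (ν m) (ν k))
  ν[k+k+m] : ν (k ℕ.+ k ℕ.+ m) ≡ ν k + ν k + ν m
  ν[k+k+m] = trans (ν-homo-+ (k ℕ.+ k) m) (cong (λ t → t + ν m) (ν-homo-+ k k))

  k≤m : k ℕ.≤ m
  -- Since `s + τ < 1`, one has `k < A * u + 1 ≤ c² * v + 1 ≤ m + 1`.
  k≤m = ν-cancel-≤ (lemma (ν c) (ν k) (ν m) A≤C k≤ ≤m)
    where
    lemma : ∀ γ κ μ → A ≤ γ * γ → κ - s - τ ≤ A * u → γ * γ * v ≤ μ → κ < 1ℚ + μ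
    lemma γ κ μ A≤C h₁ h₂ = <-by
      (0<τ ⊞ (gap h₁ ⊕ gap small ⊕ 0≤2s ⊕ 0≤τ ⊕ gap A≤C ⊗ 0≤v ⊕ gap h₂ ⊕ 0≤A ⊗ gap u≤v))
      (solve (γ ∷ κ ∷ μ ∷ s ∷ τ ∷ A ∷ u ∷ v ∷ []) ℚ-ring)
      where
      0≤A : 0ℚ ≤ A
      0≤A = subst (0ℚ ≤_) (sym A≡) ((0≤ν c ⊕ 0≤ν c) ⊕ 0≤const (1ℚ + 1ℚ))

  A-lower : ν k ≤ 1ℚ + A * u
  A-lower = lemma (ν k) k≤
    where
    lemma : ∀ κ → κ - s - τ ≤ A * u → κ ≤ 1ℚ + A * u
    lemma κ h = ≤-by (gap h ⊕ gap small ⊕ 0≤2s ⊕ 0≤τ ⊕ 0≤τ) (solve (κ ∷ s ∷ τ ∷ A ∷ u ∷ []) ℚ-ring)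

  A-upper : A * v ≤ ν k
  A-upper = lemma (ν k) ≤k
    where
    lemma : ∀ κ → A * v ≤ κ - s → A * v ≤ κ
    lemma κ h = ≤-by (gap h ⊕ 0≤s) (solve (κ ∷ s ∷ A ∷ v ∷ []) ℚ-ring)

  C-lower : ∀ γ μ → μ - τ ≤ γ * γ * u → μ ≤ 1ℚ + γ * γ * u
  C-lower γ μ h = ≤-by (gap h ⊕ gap small ⊕ 0≤2s ⊕ 0≤s ⊕ 0≤τ ⊕ 0≤τ) (solve (γ ∷ μ ∷ s ∷ τ ∷ u ∷ []) ℚ-ring)

  2k-lower : ∀ κ → κ - s - τ ≤ A * u → z ≡ κ + κ → z ≤ 1ℚ + (A + A + 1ℚ) * u
  2k-lower κ h refl = ≤-by (gap h ⊕ gap h ⊕ gap small ⊕ 0≤s ⊕ 0≤τ ⊕ 0≤u) (solve (κ ∷ s ∷ τ ∷ A ∷ u ∷ []) ℚ-ring)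

  -- The extra 1 in `d² = 2A + 1` costs `v`, which the doubled defect `s + s` pays for.
  2k-upper : ∀ κ → A * v ≤ κ - s → z ≡ κ + κ → (A + A + 1ℚ) * v ≤ z
  2k-upper κ h refl = ≤-by (gap h ⊕ gap h ⊕ gap v≤2s) (solve (κ ∷ s ∷ A ∷ v ∷ []) ℚ-ring)

  -- As `(c + 1)²` is one less than `c² + A`, the defect grows by `u ≤ s + s`, to at most `3s + 2τ`.
  -- This case needs all of `s + s + s` in `small`, whence the bound 2/3.
  k+m-lower : ∀ γ κ μ → κ - s - τ ≤ A * u → μ - τ ≤ γ * γ * u → z ≡ κ + μ →
              z ≤ 1ℚ + (γ * γ + A - 1ℚ) * u
  k+m-lower γ κ μ h₁ h₂ refl = ≤-by (gap h₁ ⊕ gap h₂ ⊕ gap small ⊕ gap u≤v ⊕ gap v≤2s ⊕ 0≤τ)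
    (solve (γ ∷ κ ∷ μ ∷ s ∷ τ ∷ A ∷ u ∷ v ∷ []) ℚ-ring)

  k+m-upper : ∀ γ κ μ → A * v ≤ κ - s → γ * γ * v ≤ μ → z ≡ κ + μ → (γ * γ + A - 1ℚ) * v ≤ z
  k+m-upper γ κ μ h₁ h₂ refl = ≤-by (gap h₁ ⊕ gap h₂ ⊕ 0≤s ⊕ 0≤v)
    (solve (γ ∷ κ ∷ μ ∷ s ∷ A ∷ v ∷ []) ℚ-ring)

  k+k+m-lower : ∀ γ κ μ → κ - s - τ ≤ A * u → μ - τ ≤ γ * γ * u → z ≡ κ + κ + μ →
                z ≤ 1ℚ + (γ * γ + (A + A)) * u
  k+k+m-lower γ κ μ h₁ h₂ refl = ≤-by (gap h₁ ⊕ gap h₁ ⊕ gap h₂ ⊕ gap small ⊕ 0≤s)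
    (solve (γ ∷ κ ∷ μ ∷ s ∷ τ ∷ A ∷ u ∷ []) ℚ-ring)

  k+k+m-upper : ∀ γ κ μ → A * v ≤ κ - s → γ * γ * v ≤ μ → z ≡ κ + κ + μ → (γ * γ + (A + A)) * v ≤ z
  k+k+m-upper γ κ μ h₁ h₂ refl = ≤-by (gap h₁ ⊕ gap h₁ ⊕ gap h₂ ⊕ 0≤2s)
    (solve (γ ∷ κ ∷ μ ∷ s ∷ A ∷ v ∷ []) ℚ-ring)

-- Almost every α

module Density {K : ℕ} {τ b : ℚ} (0<τ : 0ℚ < τ) (small : (1ℚ + ½) * b + (τ + τ + τ) ≤ 1ℚ) where

  0≤τ = <⇒≤ 0<τ

  module _ {u v : ℚ} (τ≤u : τ ≤ u) (u<v : u < v) (v≤b : v ≤ b) where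

    0<v-u = gap-< u<v
    0≤v-u = <⇒≤ 0<v-u

    0≤b : 0ℚ ≤ b
    0≤b = ≤-trans 0≤τ (≤-trans τ≤u (≤-trans (<⇒≤ u<v) v≤b))

    τ≤1 : τ ≤ 1ℚ
    τ≤1 = ≤-by (gap small ⊕ (0≤const (1ℚ + ½)) ⊗ 0≤b ⊕ 0≤τ ⊕ 0≤τ) (solve (τ ∷ b ∷ []) ℚ-ring)

    v-u≤1 : v - u ≤ 1ℚ
    v-u≤1 = ≤-by (gap small ⊕ 0≤const ½ ⊗ 0≤b ⊕ 0≤τ ⊕ 0≤τ ⊕ gap τ≤u ⊕ 0≤τ ⊕ 0≤τ ⊕ gap v≤b)
      (solve (τ ∷ b ∷ u ∷ v ∷ []) ℚ-ring)

    -- The 16 makes `[u, v]` at least four cells of length `1 / A` long, and a window of length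
    -- `τ / A` at least four cells of length `1 / C`. The summand `ν K` forces `k > K`.
    threshold = archimedean (*-pos 0<τ 0<v-u) (+ 16 / 1 + ν K)
    c = proj₁ (pell-above (proj₁ threshold))
    P = proj₂ (proj₂ (pell-above (proj₁ threshold)))
    γ = ν c
    A = γ + γ + (1ℚ + 1ℚ)
    C = γ * γ

    1≤γ : 1ℚ ≤ γ
    1≤γ = subst (_≤ γ) 1ν (ν-mono-≤ (Pell.1≤c P))

    0≤γ : 0ℚ ≤ γ
    0≤γ = 0≤ν c

    γ-large : + 16 / 1 + ν K ≤ γ * (τ * (v - u))
    γ-large = ≤-trans (proj₂ threshold)
      (*-monoʳ-≤-nonNeg (τ * (v - u)) {{nonNegative (0≤τ ⊗ 0≤v-u)}} (ν-mono-≤ (proj₁ (proj₂ (pell-above (proj₁ threshold))))))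

    γ[v-u]-large : + 16 / 1 ≤ γ * (v - u)
    γ[v-u]-large = lemma γ (ν K) 0≤γ (0≤ν K) γ-large
      where
      lemma : ∀ γ K → 0ℚ ≤ γ → 0ℚ ≤ K → + 16 / 1 + K ≤ γ * (τ * (v - u)) → + 16 / 1 ≤ γ * (v - u)
      lemma γ K 0≤γ 0≤K h = ≤-by (gap h ⊕ 0≤K ⊕ 0≤γ ⊗ 0≤v-u ⊗ gap τ≤1) (solve (γ ∷ K ∷ τ ∷ u ∷ v ∷ []) ℚ-ring)

    γτ-large : + 16 / 1 + ν K ≤ γ * τ
    γτ-large = lemma γ (ν K) 0≤γ γ-large
      where
      lemma : ∀ γ K → 0ℚ ≤ γ → + 16 / 1 + K ≤ γ * (τ * (v - u)) → + 16 / 1 + K ≤ γ * τ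
      lemma γ K 0≤γ h = ≤-by (gap h ⊕ 0≤γ ⊗ 0≤τ ⊗ gap v-u≤1) (solve (γ ∷ K ∷ τ ∷ u ∷ v ∷ []) ℚ-ring)

    16≤γ : + 16 / 1 ≤ γ
    16≤γ = lemma γ (ν K) 0≤γ (0≤ν K) γτ-large
      where
      lemma : ∀ γ K → 0ℚ ≤ γ → 0ℚ ≤ K → + 16 / 1 + K ≤ γ * τ → + 16 / 1 ≤ γ
      lemma γ K 0≤γ 0≤K h = ≤-by (gap h ⊕ 0≤K ⊕ 0≤γ ⊗ gap τ≤1) (solve (γ ∷ K ∷ τ ∷ []) ℚ-ring)

    0<A : 0ℚ < A
    0<A = subst (0ℚ <_) (+-comm (1ℚ + 1ℚ) (γ + γ)) (positive⁻¹ (1ℚ + 1ℚ) ⊞ (0≤γ ⊕ 0≤γ))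

    0<C : 0ℚ < C
    0<C = let 0<γ = <-≤-trans (positive⁻¹ 1ℚ) 1≤γ in *-pos 0<γ 0<γ

    A-large : 1ℚ + 1ℚ + 1ℚ + 1ℚ ≤ A * (v - u)
    A-large = lemma γ γ[v-u]-large
      where
      lemma : ∀ γ → + 16 / 1 ≤ γ * (v - u) → 1ℚ + 1ℚ + 1ℚ + 1ℚ ≤ (γ + γ + (1ℚ + 1ℚ)) * (v - u)
      lemma γ h = ≤-by (gap h ⊕ gap h ⊕ 0≤v-u ⊕ 0≤v-u ⊕ 0≤const (+ 28 / 1)) (solve (γ ∷ u ∷ v ∷ []) ℚ-ring)

    A≤C : A ≤ C
    A≤C = lemma γ 16≤γ 0≤γ 1≤γ
      where
      lemma : ∀ γ → + 16 / 1 ≤ γ → 0ℚ ≤ γ → 1ℚ ≤ γ → γ + γ + (1ℚ + 1ℚ) ≤ γ * γ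
      lemma γ h 0≤γ 1≤γ = ≤-by (0≤γ ⊗ gap h ⊕ 0≤const (+ 12 / 1) ⊗ 0≤γ ⊕ gap 1≤γ ⊕ gap 1≤γ) (solve (γ ∷ []) ℚ-ring)

    4A≤Cτ : (1ℚ + 1ℚ + 1ℚ + 1ℚ) * A ≤ C * τ
    4A≤Cτ = lemma γ (ν K) γτ-large 0≤γ (0≤ν K) 1≤γ
      where
      lemma : ∀ γ K → + 16 / 1 + K ≤ γ * τ → 0ℚ ≤ γ → 0ℚ ≤ K → 1ℚ ≤ γ →
              (1ℚ + 1ℚ + 1ℚ + 1ℚ) * (γ + γ + (1ℚ + 1ℚ)) ≤ γ * γ * τ
      lemma γ K h 0≤γ 0≤K 1≤γ = ≤-by (0≤γ ⊗ (gap h ⊕ 0≤K) ⊕ 0≤const (+ 8 / 1) ⊗ gap 1≤γ)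
        (solve (γ ∷ K ∷ τ ∷ []) ℚ-ring)

    K≤Aτ : ν K ≤ A * τ
    K≤Aτ = lemma γ (ν K) γτ-large 0≤γ
      where
      lemma : ∀ γ K → + 16 / 1 + K ≤ γ * τ → 0ℚ ≤ γ → K ≤ (γ + γ + (1ℚ + 1ℚ)) * τ
      lemma γ K h 0≤γ = ≤-by (gap h ⊕ 0≤const (+ 16 / 1) ⊕ 0≤γ ⊗ 0≤τ ⊕ 0≤τ ⊕ 0≤τ) (solve (γ ∷ K ∷ τ ∷ []) ℚ-ring)

    r = proj₁ (reciprocal 0<A)
    0<r = proj₁ (proj₂ (reciprocal 0<A))
    0≤r = <⇒≤ 0<r
    rA≡1 = proj₂ (proj₂ (reciprocal 0<A))
    R = proj₁ (reciprocal 0<C)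
    0<R = proj₁ (proj₂ (reciprocal 0<C))
    0≤R = <⇒≤ 0<R
    RC≡1 = proj₂ (proj₂ (reciprocal 0<C))

    module _ (i : ℕ) (u≤ir : u ≤ ν i * r) (kr≤v : ν (suc i) * r ≤ v) where

      κ = ν (suc i)
      -- With `k = i + 1`, `s` is half the right end of the cell, so `α ≤ 2s` on all of it. The
      -- window `[p, q]` consists of the `α` with `k - A α` in `[s, s + τ]`.
      s = ½ * (κ * r)
      p = (κ - s - τ) * r
      q = (κ - s) * r

      K<k : K ℕ.< suc i
      -- `K ≤ A τ ≤ A u ≤ i`, and `k` is `i + 1`.
      K<k = ℕ.s≤s (ν-cancel-≤ (lemma (ν i) A r (ν K) u≤ir rA≡1 K≤Aτ (<⇒≤ 0<A)))
        where
        lemma : ∀ I A r K → u ≤ I * r → r * A ≡ 1ℚ → K ≤ A * τ → 0ℚ ≤ A → K < 1ℚ + I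
        lemma I A r K h₁ rA≡1 h₂ 0≤A = <-by (positive⁻¹ 1ℚ ⊞ (gap h₂ ⊕ 0≤A ⊗ gap τ≤u ⊕ 0≤A ⊗ gap h₁ ⊕ eqGap I rA≡1))
          (solve (I ∷ A ∷ r ∷ K ∷ τ ∷ u ∷ []) ℚ-ring)

      0≤s : 0ℚ ≤ s
      0≤s = 0≤const ½ ⊗ 0≤ν (suc i) ⊗ 0≤r

      s-small : s + s + s + (τ + τ + τ) ≤ 1ℚ
      s-small = lemma κ r kr≤v
        where
        lemma : ∀ κ r → κ * r ≤ v →
                ½ * (κ * r) + ½ * (κ * r) + ½ * (κ * r) + (τ + τ + τ) ≤ 1ℚ
        lemma κ r h = ≤-by (gap small ⊕ 0≤const (1ℚ + ½) ⊗ (gap h ⊕ gap v≤b)) (solve (κ ∷ r ∷ τ ∷ v ∷ b ∷ []) ℚ-ring)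

      ir≤p : ν i * r ≤ p
      ir≤p = lemma (ν i) κ s r (ν-suc i) s-small 0≤s 0≤r
        where
        lemma : ∀ I κ s r → κ ≡ 1ℚ + I → s + s + s + (τ + τ + τ) ≤ 1ℚ → 0ℚ ≤ s → 0ℚ ≤ r → I * r ≤ (κ - s - τ) * r
        lemma I _ s r refl h 0≤s 0≤r = ≤-by (0≤r ⊗ (gap h ⊕ 0≤s ⊕ 0≤s ⊕ 0≤τ ⊕ 0≤τ)) (solve (I ∷ s ∷ r ∷ τ ∷ []) ℚ-ring)

      q≤kr : q ≤ κ * r
      q≤kr = lemma κ s r 0≤s 0≤r
        where
        lemma : ∀ κ s r → 0ℚ ≤ s → 0ℚ ≤ r → (κ - s) * r ≤ κ * r
        lemma κ s r 0≤s 0≤r = ≤-by (0≤s ⊗ 0≤r) (solve (κ ∷ s ∷ r ∷ []) ℚ-ring)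

      u≤p : u ≤ p
      u≤p = ≤-trans u≤ir ir≤p

      C-large : 1ℚ + 1ℚ + 1ℚ + 1ℚ ≤ C * (q - p)
      C-large = lemma κ s r A C 0≤r rA≡1 4A≤Cτ
        where
        lemma : ∀ κ s r A C → 0ℚ ≤ r → r * A ≡ 1ℚ → (1ℚ + 1ℚ + 1ℚ + 1ℚ) * A ≤ C * τ →
                1ℚ + 1ℚ + 1ℚ + 1ℚ ≤ C * ((κ - s) * r - (κ - s - τ) * r)
        lemma κ s r A C 0≤r rA≡1 h = ≤-by (0≤r ⊗ gap h ⊕ eqGap (- (1ℚ + 1ℚ + 1ℚ + 1ℚ)) rA≡1)
          (solve (κ ∷ s ∷ r ∷ A ∷ C ∷ τ ∷ []) ℚ-ring)

      module _ (j : ℕ) (p≤jR : p ≤ ν j * R) (mR≤q : ν (suc j) * R ≤ q) where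

        μ = ν (suc j)
        -- On `[u′, v′]` the defect `m - C α` runs through `[0, τ]`.
        u′ = (μ - τ) * R
        v′ = μ * R

        jR≤u′ : ν j * R ≤ u′
        jR≤u′ = lemma (ν j) μ R (ν-suc j) 0≤R
          where
          lemma : ∀ J μ R → μ ≡ 1ℚ + J → 0ℚ ≤ R → J * R ≤ (μ - τ) * R
          lemma J _ R refl 0≤R = ≤-by (0≤R ⊗ gap τ≤1) (solve (J ∷ R ∷ τ ∷ []) ℚ-ring)

        p≤u′ : p ≤ u′
        p≤u′ = ≤-trans p≤jR jR≤u′

        u′≤v′ : u′ ≤ v′
        u′≤v′ = lemma μ R 0≤R
          where
          lemma : ∀ μ R → 0ℚ ≤ R → (μ - τ) * R ≤ μ * R
          lemma μ R 0≤R = ≤-by (0≤τ ⊗ 0≤R) (solve (μ ∷ R ∷ τ ∷ []) ℚ-ring)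

        inner-solved : Solved K u′ v′
        inner-solved = solved {τ} {u′} {v′} {K} {suc i} {suc j} {c} {A} {s} P K<k refl 0<τ s-small
          (<-≤-trans 0<τ (≤-trans τ≤u (≤-trans u≤p p≤u′))) u′≤v′
          (≤-trans mR≤q (≤-trans q≤kr (≤-reflexive (double κ r)))) A≤C
          (scale-lower (κ - s - τ) r A u′ rA≡1 (<⇒≤ 0<A) p≤u′)
          (scale-upper (κ - s) r A v′ rA≡1 (<⇒≤ 0<A) mR≤q)
          (scale-lower (μ - τ) R C u′ RC≡1 (<⇒≤ 0<C) ≤-refl)
          (scale-upper μ R C v′ RC≡1 (<⇒≤ 0<C) ≤-refl)
          where
          double : ∀ κ r → κ * r ≡ ½ * (κ * r) + ½ * (κ * r)
          double = solve-∀ ℚ-ring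
          scale-lower : ∀ x r A w → r * A ≡ 1ℚ → 0ℚ ≤ A → x * r ≤ w → x ≤ A * w
          scale-lower x r A w rA≡1 0≤A h = ≤-by (0≤A ⊗ gap h ⊕ eqGap (- x) rA≡1) (solve (x ∷ r ∷ A ∷ w ∷ []) ℚ-ring)
          scale-upper : ∀ x r A w → r * A ≡ 1ℚ → 0ℚ ≤ A → w ≤ x * r → A * w ≤ x
          scale-upper x r A w rA≡1 0≤A h = ≤-by (0≤A ⊗ gap h ⊕ eqGap x rA≡1) (solve (x ∷ r ∷ A ∷ w ∷ []) ℚ-ring)

        inner-cell : Σ (Dissection (Solved K) (ν j * R) (ν (suc j) * R)) λ D → waste D ≤ (1ℚ - τ) * R
        inner-cell = cut (bad jR≤u′) (good u′≤v′ inner-solved) , lemma (ν j) μ R (ν-suc j)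
          where
          lemma : ∀ J μ R → μ ≡ 1ℚ + J → (μ - τ) * R - J * R + 0ℚ ≤ (1ℚ - τ) * R
          lemma J _ R refl = ≤-reflexive (solve (J ∷ R ∷ τ ∷ []) ℚ-ring)

      inner : Σ (Dissection (Solved K) p q) λ D → waste D ≤ (1ℚ - ½ * τ) * (q - p)
      inner = tile {r = R} {A = C} 0<R RC≡1 (<⇒≤ 0<C) 0≤τ (≤-trans 0≤τ (≤-trans τ≤u u≤p)) C-large inner-cell

      -- The window has length `τ * r`, and `inner` makes the proportion `τ / 2` of it good.
      outer-cell : Σ (Dissection (Solved K) (ν i * r) (ν (suc i) * r)) λ D → waste D ≤ (1ℚ - ½ * (τ * τ)) * r
      outer-cell = cut (bad ir≤p) (cut (proj₁ inner) (bad q≤kr)) ,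
        lemma (ν i) κ s r (waste (proj₁ inner)) (ν-suc i) (proj₂ inner)
        where
        lemma : ∀ I κ s r d → κ ≡ 1ℚ + I → d ≤ (1ℚ - ½ * τ) * ((κ - s) * r - (κ - s - τ) * r) →
                (κ - s - τ) * r - I * r + (d + (κ * r - (κ - s) * r)) ≤ (1ℚ - ½ * (τ * τ)) * r
        lemma I _ s r d refl h = ≤-by (gap h) (solve (I ∷ s ∷ r ∷ d ∷ τ ∷ []) ℚ-ring)

    outer : Σ (Dissection (Solved K) u v) λ D → waste D ≤ (1ℚ - ½ * (½ * (τ * τ))) * (v - u)
    outer = tile {r = r} {A = A} 0<r rA≡1 (<⇒≤ 0<A) (0≤const ½ ⊗ 0≤τ ⊗ 0≤τ) (≤-trans 0≤τ τ≤u) A-large outer-cell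

  -- Tiling at the outer scale halves the proportion once more, to `τ² / 4`. It does not depend on
  -- `u` and `v`, as the iteration requires.
  dense : DenseOn (Solved K) (½ * (½ * (τ * τ))) τ b
  dense {u} {v} τ≤u u≤v v≤b = split (u <? v)
    where
    lemma : v ≤ u → v - u ≤ (1ℚ - ½ * (½ * (τ * τ))) * (v - u)
    lemma v≤u = ≤-by (0≤const ½ ⊗ 0≤const ½ ⊗ 0≤τ ⊗ 0≤τ ⊗ gap v≤u) (solve (u ∷ v ∷ τ ∷ []) ℚ-ring)
    split : Dec (u < v) → Σ (Dissection (Solved K) u v) λ D → waste D ≤ (1ℚ - ½ * (½ * (τ * τ))) * (v - u)
    split (yes u<v) = outer τ≤u u<v v≤b
    split (no  u≮v) = bad u≤v , lemma (≮⇒≥ u≮v)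

  0<density : 0ℚ < ½ * (½ * (τ * τ))
  0<density = *-pos (positive⁻¹ ½) (*-pos (positive⁻¹ ½) (*-pos 0<τ 0<τ))

-- Each triple is chosen with its first entry above that of the previous one, so the first entries
-- increase strictly.
infinite : ∀ {X : Pred (ℕ × ℕ × ℕ) 0ℓ} → (∀ K → ∃₂ λ k m → K ℕ.< k × (k , k , m) ∈ X) → Infinite X
infinite {X} unbounded = f , injective , f∈X
  where
  above : ℕ → ℕ × ℕ × ℕ
  above K = let k , m , _ = unbounded K in k , k , m
  f : ℕ → ℕ × ℕ × ℕ
  f zero    = above 0
  f (suc n) = above (proj₁ (f n))
  f∈X : ∀ n → f n ∈ X
  f∈X zero    = proj₂ (proj₂ (proj₂ (unbounded 0)))
  f∈X (suc n) = proj₂ (proj₂ (proj₂ (unbounded (proj₁ (f n)))))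
  step : ∀ n → proj₁ (f n) ℕ.< proj₁ (f (suc n))
  step n = proj₁ (proj₂ (proj₂ (unbounded (proj₁ (f n)))))
  increasing : ∀ {i j} → i ℕ.<′ j → proj₁ (f i) ℕ.< proj₁ (f j)
  increasing {i} ℕ.≤′-refl         = step i
  increasing {j = suc j} (ℕ.≤′-step i<j) = ℕ.<-trans (increasing i<j) (step j)
  injective : Injective _≡_ _≡_ f
  injective {i} {j} eq with ℕ.<-cmp i j
  ... | tri< i<j _ _ = contradiction (cong proj₁ eq) (ℕ.<⇒≢ (increasing (ℕ.<⇒<′ i<j)))
  ... | tri≈ _ i≡j _ = i≡j
  ... | tri> _ _ j<i = contradiction (cong proj₁ (sym eq)) (ℕ.<⇒≢ (increasing (ℕ.<⇒<′ j<i)))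

-- Exhausting (0, 2/3) by closed subintervals

0<ν[1+n] : ∀ n → 0ℚ < ν (suc n)
0<ν[1+n] n = subst (0ℚ <_) (sym (ν-suc n)) (positive⁻¹ 1ℚ ⊞ 0≤ν n)

-- This is `1 / (9 + s)`; the 9 keeps the interval from `τ` to `2/3 - 2τ` nonempty from the first
-- stage on.
margin : ℕ → ℚ
margin s = proj₁ (reciprocal (0<ν[1+n] (8 ℕ.+ s)))

0<margin : ∀ s → 0ℚ < margin s
0<margin s = proj₁ (proj₂ (reciprocal (0<ν[1+n] (8 ℕ.+ s))))

margin-shrinks : 0ℚ < ε → ∃ λ n → ∀ s → n ℕ.≤ s → margin s + margin s + margin s ≤ ε
margin-shrinks {ε} 0<ε = n , λ s n≤s →
  lemma (margin s) (ν n) (ν (9 ℕ.+ s)) (<⇒≤ (0<margin s)) (ν-mono-≤ (ℕ.≤-trans n≤s (ℕ.m≤n+m s 9)))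
    (proj₂ (proj₂ (reciprocal (0<ν[1+n] (8 ℕ.+ s))))) (proj₂ large)
  where
  large = archimedean 0<ε (1ℚ + 1ℚ + 1ℚ)
  n = proj₁ large
  lemma : ∀ τ n S → 0ℚ ≤ τ → n ≤ S → τ * S ≡ 1ℚ → 1ℚ + 1ℚ + 1ℚ ≤ n * ε → τ + τ + τ ≤ ε
  lemma τ n S 0≤τ n≤S τS≡1 h = ≤-by (0≤τ ⊗ gap h ⊕ 0≤τ ⊗ gap n≤S ⊗ <⇒≤ 0<ε ⊕ eqGap ε τS≡1)
    (solve (τ ∷ n ∷ S ∷ ε ∷ []) ℚ-ring)

9*margin≤1 : ∀ s → + 9 / 1 * margin s ≤ 1ℚ
9*margin≤1 s = lemma (margin s) (ν (9 ℕ.+ s)) (<⇒≤ (0<margin s))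
    (subst (_≤ ν (9 ℕ.+ s)) (sym (ι-def (+ 9))) (ν-mono-≤ (ℕ.m≤m+n 9 s)))
    (proj₂ (proj₂ (reciprocal (0<ν[1+n] (8 ℕ.+ s)))))
  where
  lemma : ∀ τ S → 0ℚ ≤ τ → + 9 / 1 ≤ S → τ * S ≡ 1ℚ → + 9 / 1 * τ ≤ 1ℚ
  lemma τ S 0≤τ h τS≡1 = ≤-by (0≤τ ⊗ gap h ⊕ eqGap 1ℚ τS≡1) (solve (τ ∷ S ∷ []) ℚ-ring)

stage : ∀ s → 0ℚ < δ → ∃ λ Is → total Is ≤ δ × Covers (Solved s) (margin s) (+ 2 / 3 - (margin s + margin s)) Is
stage {δ} s 0<δ = proj₁ covering , ≤-trans (proj₁ (proj₂ covering)) total≤ , proj₂ (proj₂ covering)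
  where
  0<½δ : 0ℚ < ½ * δ
  0<½δ = *-pos (positive⁻¹ ½) 0<δ
  -- The right end `2/3 - 2τ` is the largest `b` that `Density` admits. Half of `δ` goes to the
  -- waste and half to the slivers of the cover.
  end : ∀ τ → (1ℚ + ½) * (+ 2 / 3 - (τ + τ)) + (τ + τ + τ) ≡ 1ℚ
  end = solve-∀ ℚ-ring
  nonempty : ∀ τ → 0ℚ < τ → + 9 / 1 * τ ≤ 1ℚ → τ ≤ + 2 / 3 - (τ + τ)
  nonempty τ 0<τ h = ≤-by (0≤const (+ 1 / 3) ⊗ gap h ⊕ 0≤const (+ 1 / 3)) (solve (τ ∷ []) ℚ-ring)
  open Density {s} {margin s} {+ 2 / 3 - (margin s + margin s)} (0<margin s) (≤-reflexive (end (margin s)))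
    using (dense; 0<density)
  dissection : Σ (Dissection (Solved s) (margin s) (+ 2 / 3 - (margin s + margin s))) λ D → waste D ≤ ½ * δ
  dissection = small-waste 0<density dense (nonempty (margin s) (0<margin s) (9*margin≤1 s)) 0<½δ
  covering = cover (proj₁ dissection) 0<½δ
  total≤ : waste (proj₁ dissection) + ½ * δ ≤ δ
  total≤ = lemma (waste (proj₁ dissection)) (proj₂ dissection)
    where
    lemma : ∀ d → d ≤ ½ * δ → d + ½ * δ ≤ δ
    lemma d h = ≤-by (gap h) (solve (d ∷ δ ∷ []) ℚ-ring)

theoremA3 : AlmostAll (OpenInterval 0ℚ (+ 2 / 3)) (λ α → Infinite (T̄ α))
theoremA3 ε 0<ε = family , length-bound budget (λ j → <⇒≤ (0<budget j)) first later , holds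
  where
  -- `budget j` is `ε / 2^(j+1)`: it bounds the total length of `L j` and equally the reserve for
  -- all later lists.
  budget : ℕ → ℚ
  budget zero    = ½ * ε
  budget (suc j) = ½ * budget j
  0<budget : ∀ j → 0ℚ < budget j
  0<budget zero    = *-pos (positive⁻¹ ½) 0<ε
  0<budget (suc j) = *-pos (positive⁻¹ ½) (0<budget j)
  L : ℕ → List Interval
  L j = proj₁ (stage j (0<budget j))
  open Concatenation L
  halves : ∀ t b → t ≤ ½ * b → t + ½ * b ≤ b
  halves t b h = ≤-by (gap h) (solve (t ∷ b ∷ []) ℚ-ring)
  first : total (L 0) + budget 0 ≤ ε
  first = halves (total (L 0)) ε (proj₁ (proj₂ (stage 0 (0<budget 0))))
  later : ∀ j → total (L (suc j)) + budget (suc j) ≤ budget j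
  later j = halves (total (L (suc j))) (budget j) (proj₁ (proj₂ (stage (suc j) (0<budget (suc j)))))
  holds : ∀ α → α ∈ OpenInterval 0ℚ (+ 2 / 3) → ¬ α ∈ ⋃ family → Infinite (T̄ α)
  holds α ((ε₁ , 0<ε₁ , N₁ , 0<α) , (ε₂ , 0<ε₂ , N₂ , α<⅔)) α∉ = infinite {T̄ α} unbounded
    where
    s₁ = proj₁ (margin-shrinks 0<ε₁)
    s₂ = proj₁ (margin-shrinks 0<ε₂)
    above : ∀ τ a → 0ℚ < τ → τ + τ + τ ≤ ε₁ → 0ℚ + ε₁ ≤ a → τ + τ ≤ a
    above τ a 0<τ h₁ h₂ = ≤-by (gap h₁ ⊕ gap h₂ ⊕ <⇒≤ 0<τ) (solve (τ ∷ a ∷ ε₁ ∷ []) ℚ-ring)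
    below : ∀ τ a → τ + τ + τ ≤ ε₂ → a + ε₂ ≤ + 2 / 3 → a + τ ≤ + 2 / 3 - (τ + τ)
    below τ a h₁ h₂ = ≤-by (gap h₁ ⊕ gap h₂) (solve (τ ∷ a ∷ ε₂ ∷ []) ℚ-ring)
    unbounded : ∀ K → ∃₂ λ k m → K ℕ.< k × (k , k , m) ∈ T̄ α
    unbounded K =
      let _ , _ , (k , m , s<k , solution) , α∈ =
            proj₂ (proj₂ (stage s (0<budget s))) α
              ( (margin s , 0<margin s , N₁ , λ n N≤n → above (margin s) (approx α n) (0<margin s) small₁ (0<α n N≤n))
              , (margin s , 0<margin s , N₂ , λ n N≤n → below (margin s) (approx α n) small₂ (α<⅔ n N≤n)))
              (∉-family {α} α∉ s)
      in k , m , ℕ.≤-<-trans (ℕ.≤-trans (ℕ.m≤m+n K s₁) (ℕ.m≤m+n (K ℕ.+ s₁) s₂)) s<k , solution α α∈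
      where
      -- The stage index has two tasks: it exceeds `K`, so that `k > K`, and it is so large that `α`
      -- lies inside the interval of that stage.
      s = K ℕ.+ s₁ ℕ.+ s₂
      small₁ = proj₂ (margin-shrinks 0<ε₁) s (ℕ.≤-trans (ℕ.m≤n+m s₁ K) (ℕ.m≤m+n (K ℕ.+ s₁) s₂))
      small₂ = proj₂ (margin-shrinks 0<ε₂) s (ℕ.m≤n+m s₂ (K ℕ.+ s₁))
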